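{- For every positive integer $r$ there exists a positive integer $k_0$ such that for every integer $k \ge k_0$ there exists a $k$-chromatic vertex-critical graph $G$ such that $\chi(G-R)=k$ for every set $R \subseteq E(G)$ with $|R|\le r$.
   Context: Graphs are finite and simple; $\chi$ denotes the chromatic number. A graph $G$ is called $k$-chromatic vertex-critical if $\chi(G)=k$ but $\chi(G-v)=k-1$ for every vertex $v\in V(G)$. For $R\subseteq E(G)$, $G-R$ denotes the graph obtained from $G$ by deleting the edges in $R$. -}

module Defs where

open import Data.Nat using (ℕ; suc; _<_; _∸_)
open import Data.Fin using (Fin; punchIn)
open import Data.Bool using (Bool; true; false; _∧_; not; _∨_)
open import Data.List using (List)
open import Data.Bool.ListAction using (any)
open import Data.Product using (_×_; _,_; Σ)
open import Relation.Binary.PropositionalEquality using (_≡_; _≢_; refl; trans; sym)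
open import Relation.Nullary using (¬_; does)
open import Data.Fin.Properties using (_≟_)

record Graph (n : ℕ) : Set where
  field
    adj    : Fin n → Fin n → Bool
    adj-sym    : ∀ u v → adj u v ≡ adj v u
    adj-irrefl : ∀ v → adj v v ≡ false
open Graph public

Colourable : ∀ {n} → Graph n → ℕ → Set
Colourable {n} G c =
  Σ (Fin n → Fin c) λ f → ∀ u v → adj G u v ≡ true → f u ≢ f v

ChromaticNumber : ∀ {n} → Graph n → ℕ → Set
ChromaticNumber G k = Colourable G k × (∀ c → c < k → ¬ Colourable G c)

deleteVertex : ∀ {n} → Graph (suc n) → Fin (suc n) → Graph n
deleteVertex G v = record
  { adj        = λ a b → adj G (punchIn v a) (punchIn v b)
  ; adj-sym    = λ a b → adj-sym G (punchIn v a) (punchIn v b)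
  ; adj-irrefl = λ a → adj-irrefl G (punchIn v a)
  }

-- k-chromatic vertex-critical (the graph has at least one vertex if k ≥ 1;
-- we index by suc n so that vertex deletion is defined)
VertexCritical : ∀ {n} → Graph (suc n) → ℕ → Set
VertexCritical G k =
  ChromaticNumber G k × (∀ v → ChromaticNumber (deleteVertex G v) (k ∸ 1))

eqb : ∀ {n} → Fin n → Fin n → Bool
eqb a b = does (a ≟ b)

joins : ∀ {n} → Fin n → Fin n → Fin n × Fin n → Bool
joins u v (a , b) = (eqb a u ∧ eqb b v) ∨ (eqb a v ∧ eqb b u)

inR : ∀ {n} → List (Fin n × Fin n) → Fin n → Fin n → Bool
inR R u v = any (joins u v) R


deleteEdges : ∀ {n} → (G : Graph n) → List (Fin n × Fin n) → Graph n
deleteEdges G R = record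
  { adj        = λ u v → adj G u v ∧ not (inR R u v)
  ; adj-sym    = λ u v → lemma u v
  ; adj-irrefl = λ v → lemma₂ v
  }
  where
  open import Data.Bool.Properties using (∨-comm; ∧-comm)
  open import Relation.Binary.PropositionalEquality using (cong₂; cong)
  open import Data.List.Properties using ()
  flipEq : ∀ u v p → joins u v p ≡ joins v u p
  flipEq u v (a , b) = ∨-comm (eqb a u ∧ eqb b v) (eqb a v ∧ eqb b u)
  anyExt : ∀ {A : Set} (f g : A → Bool) → (∀ x → f x ≡ g x) → ∀ xs → any f xs ≡ any g xs
  anyExt f g h List.[] = refl
  anyExt f g h (x List.∷ xs) = cong₂ _∨_ (h x) (anyExt f g h xs)
  lemma : ∀ u v → (adj G u v ∧ not (inR R u v)) ≡ (adj G v u ∧ not (inR R v u))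
  lemma u v = cong₂ (λ x y → x ∧ not y) (adj-sym G u v) (anyExt _ _ (flipEq u v) R)
  lemma₂ : ∀ v → (adj G v v ∧ not (inR R v v)) ≡ false
  lemma₂ v rewrite adj-irrefl G v = refl

AllEdges : ∀ {n} → Graph n → List (Fin n × Fin n) → Set
AllEdges G R = ∀ {u v} → (u , v) Data.List.Membership.Propositional.∈ R → adj G u v ≡ true
  where import Data.List.Membership.Propositional

module Submission where

{- Edges of the complement. Call two vertices of G compatible if they are equal or non-adjacent.
Put a = 2r + 1 and let n = AB + 1, where A = pa and B = qa with p, q ≥ 3. On ℤ/n declare u and v
compatible if u − v = x + yA with |x|, |y| < a, so that the a × a squares {t + x + yA : 0 ≤ x, y < a}
are independent sets of G. Cutting the A × B rectangle v + 1, …, v + AB into squares colours G − v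
with pq colours for every v. Gluing two such graphs at one vertex, all other pairs across being
adjacent in G, keeps this property and adds the values of pq; so m = k − 1 colours occur for all
m = 3s + 4t with s, t ≥ 3, hence for all m ≥ 29, and |V| = m a² + 1.

An m-colouring of G − R would have a class W with more than a² vertices, in which all incompatible
pairs lie in R. A vertex of W that is not an endpoint of R is compatible with all of W; around it (if
it is not the glued vertex) compatibility is computed in plane coordinates (X, Y). By pigeonhole two
points P, Q of W have coordinates congruent mod a, say X P + a ≤ X Q. All non-endpoints
are compatible with both, so none of them has an X-coordinate congruent to X P, and being pairwise
compatible they are distinguished by their residues: |W| ≤ 2r + (a − 1) a < a², a contradiction. -}

open import Defs
open import Data.Nat
open import Data.Nat.Properties
open import Data.Nat.DivMod
open import Data.Nat.Tactic.RingSolver using (solve-∀)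
open import Data.Bool using (true; false; not; _∧_)
open import Data.Empty using (⊥)
open import Data.Fin as Fin using (Fin; toℕ; fromℕ<; punchIn; punchOut)
import Data.Fin.Properties as Fin
open import Data.List using (List; []; _∷_; length; lookup; filter)
open import Data.List.Membership.DecPropositional using () renaming (_∈?_ to member?)
open import Data.List.Membership.Propositional using (_∈_; _∉_)
open import Data.List.Membership.Propositional.Properties using (∈-lookup)
open import Data.List.Membership.Setoid.Properties using (index-injective)
open import Data.List.Properties using (length-tabulate)
open import Data.List.Relation.Unary.All as All using (All; []; _∷_)
import Data.List.Relation.Unary.All.Properties as All
open import Data.List.Relation.Unary.AllPairs using (_∷_)
open import Data.List.Relation.Unary.Any as Any using (here; there)
open import Data.List.Relation.Unary.Any.Properties using (lookup-index)
open import Data.List.Relation.Unary.Unique.Propositional using (Unique)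
import Data.List.Relation.Unary.Unique.Propositional.Properties as Unique
open import Data.Product using (Σ; ∃; _×_; _,_; proj₁; proj₂)
open import Data.Sum using (_⊎_; inj₁; inj₂; [_,_]′)
open import Data.Sum.Properties using (inj₂-injective)
open import Data.Unit using (⊤; tt)
open import Function using (_∘_; mk⇔; case_of_)
open import Relation.Binary.Definitions using (tri<; tri≈; tri>)
open import Relation.Binary.PropositionalEquality hiding (J)
open import Relation.Binary.Bundles using (Setoid)
import Relation.Binary.Reasoning.Setoid as SetoidReasoning
open import Relation.Binary.Structures using (IsEquivalence)
open import Relation.Nullary
open import Relation.Nullary.Decidable using (_×-dec_; _⊎-dec_; ¬?; map′; does-⇔; dec-true)
open import Relation.Unary using (Decidable)
open import Relation.Unary.Properties using (∁?)

-- Lists and a pigeonhole principle.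

lookup-injective : ∀ {A : Set} {xs : List A} → Unique xs →
  ∀ {i j} → lookup xs i ≡ lookup xs j → i ≡ j
lookup-injective (_ ∷ _)  {Fin.zero}  {Fin.zero}  _  = refl
lookup-injective (≢x ∷ _) {Fin.zero}  {Fin.suc j} eq = contradiction eq (All.lookup ≢x (∈-lookup j))
lookup-injective (≢x ∷ _) {Fin.suc i} {Fin.zero}  eq = contradiction (sym eq) (All.lookup ≢x (∈-lookup i))
lookup-injective (_ ∷ u)  {Fin.suc i} {Fin.suc j} eq = cong Fin.suc (lookup-injective u eq)

length-filter-∁ : ∀ {A : Set} {P : A → Set} (P? : Decidable P) xs →
  length (filter P? xs) + length (filter (∁? P?) xs) ≡ length xs
length-filter-∁ P? []       = refl
length-filter-∁ P? (x ∷ xs) with does (P? x)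
... | true  = cong suc (length-filter-∁ P? xs)
... | false = trans (+-suc _ _) (cong suc (length-filter-∁ P? xs))

-- Peel off the top colour: if its class has at most `s` elements, more than `m * s` elements remain
-- for the `m` smaller colours.
large-class : ∀ {A : Set} (f : A → ℕ) s m {xs} → Unique xs → All (λ x → f x < m) xs →
  m * s < length xs → ∃ λ ys → Unique ys × s < length ys × ∃ λ c → All (λ x → f x ≡ c) ys
large-class f s zero    {x ∷ xs} _ (() ∷ _) _
large-class f s (suc m) {xs} u f<1+m big with s <? length (filter (λ x → f x ≟ m) xs)
... | yes s< = _ , Unique.filter⁺ m? u , s< , m , All.all-filter m? xs
  where m? = λ x → f x ≟ m
... | no s≮ = large-class f s m (Unique.filter⁺ (∁? m?) u)
    (All.zipWith (λ (<1+m , ≢m) → ≤∧≢⇒< (s≤s⁻¹ <1+m) ≢m)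
      (All.filter⁺ (∁? m?) f<1+m , All.all-filter (∁? m?) xs))
    (+-cancelˡ-< s _ _ (<-≤-trans big (≤-trans (≤-reflexive (sym (length-filter-∁ m? xs)))
      (+-monoˡ-≤ _ (≮⇒≥ s≮)))))
  where m? = λ x → f x ≟ m

-- Residues and distances.

≡%⇒+≤ : ∀ a .{{_ : NonZero a}} {x y} → x % a ≡ y % a → x < y → x + a ≤ y
≡%⇒+≤ a {x} {y} eq x<y with x / a <? y / a
... | yes lt = begin
  x + a                       ≡⟨ cong (_+ a) (m≡m%n+[m/n]*n x a) ⟩
  x % a + x / a * a + a       ≡⟨ +-assoc (x % a) _ a ⟩
  x % a + (x / a * a + a)     ≡⟨ cong (x % a +_) (+-comm _ a) ⟩
  x % a + suc (x / a) * a     ≤⟨ +-mono-≤ (≤-reflexive eq) (*-monoˡ-≤ a lt) ⟩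
  y % a + y / a * a           ≡⟨ m≡m%n+[m/n]*n y a ⟨
  y                           ∎
  where open ≤-Reasoning
... | no nlt = contradiction x<y (≤⇒≯ (begin
  y                           ≡⟨ m≡m%n+[m/n]*n y a ⟩
  y % a + y / a * a           ≤⟨ +-mono-≤ (≤-reflexive (sym eq)) (*-monoˡ-≤ a (≮⇒≥ nlt)) ⟩
  x % a + x / a * a           ≡⟨ m≡m%n+[m/n]*n x a ⟨
  x                           ∎))
  where open ≤-Reasoning

≡%∧near⇒≡ : ∀ a .{{_ : NonZero a}} {x y} → x % a ≡ y % a → x < y + a → y < x + a → x ≡ y
≡%∧near⇒≡ a {x} {y} eq x< y< with <-cmp x y
... | tri< lt _ _ = contradiction y< (≤⇒≯ (≡%⇒+≤ a eq lt))
... | tri≈ _ e _ = e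
... | tri> _ _ gt = contradiction x< (≤⇒≯ (≡%⇒+≤ a (sym eq) gt))

residue : ∀ a .{{_ : NonZero a}} → ℕ → Fin a
residue a x = fromℕ< (m%n<n x a)

residue-injective : ∀ a .{{_ : NonZero a}} x y → residue a x ≡ residue a y → x % a ≡ y % a
residue-injective a x y eq = trans (sym (Fin.toℕ-fromℕ< _)) (trans (cong toℕ eq) (Fin.toℕ-fromℕ< _))

-- Near-cliques in planar coordinates.

-- The squares have side a = suc c.
record Chart {V : Set} (K : V → V → Set) (c : ℕ) : Set where
  field
    X Y   : V → ℕ
    nearX : ∀ {u v} → K u v → X u < X v + suc c
    nearY : ∀ {u v} → K u v → Y u < Y v + suc c
    XY-injective : ∀ {u v} → X u ≡ X v → Y u ≡ Y v → u ≡ v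

transpose : ∀ {V K c} → Chart {V} K c → Chart K c
transpose φ = record { X = Y ; Y = X ; nearX = nearY ; nearY = nearX ; XY-injective = λ eX eY → XY-injective eY eX }
  where open Chart φ

-- A slot stands for an endpoint of a deleted edge.
module _ {N c t : ℕ} {K : Fin N → Fin N → Set} (K-sym : ∀ {i j} → K i j → K j i)
  (slot : Fin N → Fin t → Set) (slot-injective : ∀ {i j s} → slot i s → slot j s → i ≡ j)
  (slot-or-free : ∀ i → (∃ λ s → slot i s) ⊎ (∀ j → K i j))
  where

  private a = suc c

  module _ (φ : Chart K c) where
    open Chart φ

    -- Here `X p + a ≤ X q`. A free `i` is near both points, so `X p < X i < X p + a`, which rules
    -- out the residue of `X p`. Free vertices thus have `c * a` possible pairs of residues; the
    -- others are counted by their slots.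
    far⇒small : ∀ {p q} → X p % a ≡ X q % a → X p < X q → N ≤ t + c * a
    far⇒small {p} {q} pq p<q = Fin.injective⇒≤ {f = code} code-injective
      where
      avoids : ∀ {i} → (∀ j → K i j) → residue a (X p) ≢ residue a (X i)
      avoids {i} free eq = <⇒≱ (nearX (free p)) (≡%⇒+≤ a (residue-injective a (X p) (X i) eq)
        (+-cancelʳ-< a _ _ (≤-<-trans (≡%⇒+≤ a pq p<q) (nearX (K-sym (free q))))))

      code′ : ∀ i → (∃ λ s → slot i s) ⊎ (∀ j → K i j) → Fin t ⊎ Fin (c * a)
      code′ i (inj₁ (s , _)) = inj₁ s
      code′ i (inj₂ free)    = inj₂ (Fin.combine (Fin.punchOut (avoids free)) (residue a (Y i)))

      code : Fin N → Fin (t + c * a)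
      code i = Fin.join t (c * a) (code′ i (slot-or-free i))

      code′-injective : ∀ {i j} u v → code′ i u ≡ code′ j v → i ≡ j
      code′-injective (inj₁ (s , si)) (inj₁ (s′ , sj)) refl = slot-injective si sj
      -- Free vertices are compatible with each other, so equal residues force equal coordinates.
      code′-injective {i} {j} (inj₂ fi) (inj₂ fj) eq
        with eX , eY ← Fin.combine-injective (Fin.punchOut (avoids fi)) (residue a (Y i)) _ _ (inj₂-injective eq)
        = XY-injective
            (≡%∧near⇒≡ a (residue-injective a (X i) (X j) (Fin.punchOut-injective (avoids fi) (avoids fj) eX))
              (nearX (fi j)) (nearX (fj i)))
            (≡%∧near⇒≡ a (residue-injective a (Y i) (Y j) eY) (nearY (fi j)) (nearY (fj i)))

      code-injective : ∀ {i j} → code i ≡ code j → i ≡ j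
      code-injective {i} {j} eq = code′-injective (slot-or-free i) (slot-or-free j)
        (trans (sym (Fin.splitAt-join t _ _)) (trans (cong (Fin.splitAt t) eq) (Fin.splitAt-join t _ _)))

  module _ (φ : Chart K c) where
    open Chart φ

    -- More than `a * a` points repeat a pair of residues. The two points differ in some coordinate,
    -- and `transpose` turns a difference in `Y` into one in `X`.
    near-clique-small : a * a < N → N ≤ t + c * a
    near-clique-small a²<N
      with p , q , p<q , eq ← Fin.pigeonhole a²<N (λ i → Fin.combine (residue a (X i)) (residue a (Y i)))
      with eX , eY ← Fin.combine-injective (residue a (X p)) (residue a (Y p)) (residue a (X q)) (residue a (Y q)) eq
      with <-cmp (X p) (X q)
    ... | tri< lt _ _ = far⇒small φ (residue-injective a (X p) (X q) eX) lt
    ... | tri> _ _ gt = far⇒small φ (sym (residue-injective a (X p) (X q) eX)) gt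
    ... | tri≈ _ Xp≡Xq _ with <-cmp (Y p) (Y q)
    ...   | tri< lt _ _ = far⇒small (transpose φ) (residue-injective a (Y p) (Y q) eY) lt
    ...   | tri> _ _ gt = far⇒small (transpose φ) (sym (residue-injective a (Y p) (Y q) eY)) gt
    ...   | tri≈ _ Yp≡Yq _ = contradiction p<q (Fin.<-irrefl (XY-injective Xp≡Xq Yp≡Yq))

-- Colourings, local charts and two-digit expansions.

-- An m-colouring of {0, …, N} ∖ {v} whose classes are K-cliques (colour v is junk).
record Colouring (K : ℕ → ℕ → Set) (N m v : ℕ) : Set where
  field
    colour   : ℕ → ℕ
    colour<m : ∀ {u} → u ≤ N → u ≢ v → colour u < m
    same⇒K   : ∀ {u w} → u ≤ N → w ≤ N → u ≢ v → w ≢ v → colour u ≡ colour w → K u w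

-- Coordinates are demanded only for families compatible with a single `z`: a cyclic structure is
-- unrolled only near a centre.
ChartAt : (ℕ → ℕ → Set) → ℕ → ℕ → ℕ → Set₁
ChartAt K N c z = ∀ {I : Set} (W : I → ℕ) → (∀ {i j} → W i ≡ W j → i ≡ j) →
  (∀ i → W i ≤ N) → (∀ i → K (W i) z) → Chart (λ i j → K (W i) (W j)) c

digits-< : ∀ {A B x y} → x < A → y < B → x + y * A < B * A
digits-< {A} {B} {x} {y} x<A y<B = <-≤-trans (+-monoˡ-< (y * A) x<A) (*-monoˡ-≤ A y<B)

digits-injective : ∀ {A x y x′ y′} → x < A → x′ < A →
  x + y * A ≡ x′ + y′ * A → x ≡ x′ × y ≡ y′
digits-injective {A} {x} {y} {x′} {y′} x<A x′<A eq = x≡x′ , y≡y′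
  where
  instance _ = >-nonZero (≤-trans (s≤s z≤n) x<A)
  x≡x′ : x ≡ x′
  x≡x′ = begin
    x                  ≡⟨ m<n⇒m%n≡m x<A ⟨
    x % A              ≡⟨ [m+kn]%n≡m%n x y A ⟨
    (x + y * A) % A    ≡⟨ cong (_% A) eq ⟩
    (x′ + y′ * A) % A  ≡⟨ [m+kn]%n≡m%n x′ y′ A ⟩
    x′ % A             ≡⟨ m<n⇒m%n≡m x′<A ⟩
    x′                 ∎
    where open ≡-Reasoning
  y≡y′ : y ≡ y′
  y≡y′ = *-cancelʳ-≡ y y′ A (+-cancelˡ-≡ x _ _ (trans eq (cong (_+ y′ * A) (sym x≡x′))))

-- Congruence modulo `suc N`, free of subtraction.

module Mod (N : ℕ) where
  private n = suc N

  infix 4 _≈_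
  -- A record rather than a synonym, so that x and y can be inferred from x ≈ y.
  record _≈_ (x y : ℕ) : Set where
    constructor mod
    field %≡ : x % n ≡ y % n
  open _≈_ public

  ≈-isEquivalence : IsEquivalence _≈_
  ≈-isEquivalence = record
    { refl  = mod refl
    ; sym   = λ p → mod (sym (%≡ p))
    ; trans = λ p q → mod (trans (%≡ p) (%≡ q))
    }

  open IsEquivalence ≈-isEquivalence public
    using () renaming (refl to ≈-refl; sym to ≈-sym; trans to ≈-trans)

  ≈-setoid : Setoid _ _
  ≈-setoid = record { isEquivalence = ≈-isEquivalence }

  module ≈-Reasoning = SetoidReasoning ≈-setoid

  %-≈ : ∀ x → x % n ≈ x
  %-≈ x = mod (m%n%n≡m%n x n)

  ≈-+ : ∀ {x y} z → x ≈ y → x + z ≈ y + z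
  ≈-+ {x} {y} z (mod eq) = mod (begin
    (x + z) % n          ≡⟨ %-distribˡ-+ x z n ⟩
    (x % n + z % n) % n  ≡⟨ cong (λ w → (w + z % n) % n) eq ⟩
    (y % n + z % n) % n  ≡⟨ %-distribˡ-+ y z n ⟨
    (y + z) % n          ∎)
    where open ≡-Reasoning

  -- N is −1 modulo n.
  ≈-mult : ∀ x z → (x + N * z) + z ≈ x
  ≈-mult x z = mod (trans (cong (_% n) (arith x N z)) ([m+kn]%n≡m%n x z n))
    where
    arith : ∀ x N z → (x + N * z) + z ≡ x + z * suc N
    arith = solve-∀

  -- Adding `N * z` to both sides subtracts `z`.
  ≈-cancel : ∀ {x y} z → x + z ≈ y + z → x ≈ y
  ≈-cancel {x} {y} z eq = begin
    x                ≈⟨ ≈-mult x z ⟨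
    (x + N * z) + z  ≡⟨ arith x N z ⟩
    (x + z) + N * z  ≈⟨ ≈-+ (N * z) eq ⟩
    (y + z) + N * z  ≡⟨ arith y N z ⟨
    (y + N * z) + z  ≈⟨ ≈-mult y z ⟩
    y                ∎
    where
    open ≈-Reasoning
    arith : ∀ x N z → (x + N * z) + z ≡ (x + z) + N * z
    arith = solve-∀

  ≈-small : ∀ {x y} → x ≤ N → y ≤ N → x ≈ y → x ≡ y
  ≈-small x≤N y≤N (mod eq) = trans (sym (m≤n⇒m%n≡m x≤N)) (trans eq (m≤n⇒m%n≡m y≤N))

-- The compatibility relation on ℤ/n.

module Torus (c p₀ q₀ : ℕ) where
  a = suc c
  -- With at least three squares per side, sums of three terms up to `c` stay below `A` and `B`, so
  -- `chartAt` meets no wrap-around.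
  p = 3 + p₀
  q = 3 + q₀
  A = p * a
  B = q * a
  N = B * A
  n = suc N
  open Mod N

  -- u − v = (i′ − i) + (j′ − j) A in ℤ/n, written without subtraction.
  data K (u v : ℕ) : Set where
    step : ∀ {i i′ j j′} → i ≤ c → i′ ≤ c → j ≤ c → j′ ≤ c →
      u + (i + j * A) ≈ v + (i′ + j′ * A) → K u v

  K-sym : ∀ {u v} → K u v → K v u
  K-sym (step i i′ j j′ eq) = step i′ i j′ j (≈-sym eq)

  K-refl : ∀ {u} → K u u
  K-refl = step z≤n z≤n z≤n z≤n ≈-refl

  K? : ∀ u v → Dec (K u v)
  K? u v = map′ to from
    (Fin.any? λ i → Fin.any? λ i′ → Fin.any? λ j → Fin.any? λ j′ →
      (u + (toℕ i + toℕ j * A)) % n ≟ (v + (toℕ i′ + toℕ j′ * A)) % n)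
    where
    Fam : Set
    Fam = ∃ λ (i : Fin a) → ∃ λ (i′ : Fin a) → ∃ λ (j : Fin a) → ∃ λ (j′ : Fin a) →
      (u + (toℕ i + toℕ j * A)) % n ≡ (v + (toℕ i′ + toℕ j′ * A)) % n
    to : Fam → K u v
    to (i , i′ , j , j′ , eq) = step (s≤s⁻¹ (Fin.toℕ<n i)) (s≤s⁻¹ (Fin.toℕ<n i′)) (s≤s⁻¹ (Fin.toℕ<n j)) (s≤s⁻¹ (Fin.toℕ<n j′)) (mod eq)
    from : K u v → Fam
    from (step {i} {i′} {j} {j′} i≤ i′≤ j≤ j′≤ (mod eq)) =
      fromℕ< (s≤s i≤) , fromℕ< (s≤s i′≤) , fromℕ< (s≤s j≤) , fromℕ< (s≤s j′≤) , eq′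
      where
      eq′ : (u + (toℕ (fromℕ< (s≤s i≤)) + toℕ (fromℕ< (s≤s j≤)) * A)) % n ≡ (v + (toℕ (fromℕ< (s≤s i′≤)) + toℕ (fromℕ< (s≤s j′≤)) * A)) % n
      eq′ rewrite Fin.toℕ-fromℕ< (s≤s i≤) | Fin.toℕ-fromℕ< (s≤s i′≤) | Fin.toℕ-fromℕ< (s≤s j≤) | Fin.toℕ-fromℕ< (s≤s j′≤) = eq

  size : N ≡ (q * p) * (a * a)
  size = arith q p a
    where
    arith : ∀ q p a → (q * a) * (p * a) ≡ (q * p) * (a * a)
    arith = solve-∀

  module _ (v : ℕ) (v≤N : v ≤ N) where
    private
      -- This is `u - (v + 1)` modulo `n`: the other vertices fill the positions `0` to `N - 1` of
      -- the rectangle, while `v` gets `N`.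
      d : ℕ → ℕ
      d u = (u + N * suc v) % n

      d+1+v≈ : ∀ u → d u + suc v ≈ u
      d+1+v≈ u = ≈-trans (≈-+ (suc v) (%-≈ (u + N * suc v))) (≈-mult u (suc v))

      d<N : ∀ {u} → u ≤ N → u ≢ v → d u < N
      d<N {u} u≤N u≢v = ≤∧≢⇒< (s≤s⁻¹ (m%n<n (u + N * suc v) n)) λ d≡N → u≢v (≈-small u≤N v≤N (begin
        u              ≈⟨ d+1+v≈ u ⟨
        d u + suc v    ≡⟨ cong (_+ suc v) d≡N ⟩
        N + suc v      ≡⟨ trans (+-suc N v) (+-comm n v) ⟩
        v + n          ≈⟨ mod ([m+n]%n≡m%n v n) ⟩
        v              ∎))
        where open ≈-Reasoning

      -- Read `D` as the cell `(D % A , D / A)`. Then `high D` encodes the corner of the square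
      -- containing it, and `low D` the offset from that corner.
      low high : ℕ → ℕ
      low  D = D % A % a + D / A % a * A
      high D = D % A / a * a + D / A / a * a * A

      split : ∀ D → D ≡ low D + high D
      split D = begin
        D                                  ≡⟨ m≡m%n+[m/n]*n D A ⟩
        D % A + D / A * A                  ≡⟨ cong₂ (λ x y → x + y * A) (m≡m%n+[m/n]*n (D % A) a) (m≡m%n+[m/n]*n (D / A) a) ⟩
        (D % A % a + D % A / a * a) + (D / A % a + D / A / a * a) * A ≡⟨ arith (D % A % a) (D % A / a * a) (D / A % a) (D / A / a * a) A ⟩
        low D + high D                     ∎
        where
        open ≡-Reasoning
        arith : ∀ i x j y A → (i + x) + (j + y) * A ≡ (i + j * A) + (x + y * A)
        arith = solve-∀

      -- When the corners agree, `u - w` is the difference of the two offsets, whose digits are at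
      -- most `c`.
      same-high⇒K : ∀ {u w} → high (d u) ≡ high (d w) → K u w
      same-high⇒K {u} {w} eq = step (digit≤ (d w % A)) (digit≤ (d u % A)) (digit≤ (d w / A)) (digit≤ (d u / A)) (begin
        u + low (d w)                     ≈⟨ ≈-+ (low (d w)) (d+1+v≈ u) ⟨
        d u + suc v + low (d w)                     ≡⟨ cong (λ x → x + suc v + low (d w)) (split (d u)) ⟩
        low (d u) + high (d u) + suc v + low (d w)  ≡⟨ arith (low (d u)) (high (d u)) (suc v) (low (d w)) ⟩
        low (d w) + high (d u) + suc v + low (d u)  ≡⟨ cong (λ x → low (d w) + x + suc v + low (d u)) eq ⟩
        low (d w) + high (d w) + suc v + low (d u)  ≡⟨ cong (λ x → x + suc v + low (d u)) (split (d w)) ⟨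
        d w + suc v + low (d u)                     ≈⟨ ≈-+ (low (d u)) (d+1+v≈ w) ⟩
        w + low (d u)                               ∎)
        where
        open ≈-Reasoning
        digit≤ : ∀ x → x % a ≤ c
        digit≤ x = s≤s⁻¹ (m%n<n x a)
        arith : ∀ l h s l′ → (l + h) + s + l′ ≡ (l′ + h) + s + l
        arith = solve-∀

      tile : ℕ → ℕ
      tile D = D % A / a + D / A / a * p

      %A/a<p : ∀ D → D % A / a < p
      %A/a<p D = m<n*o⇒m/o<n (m%n<n D A)

      tile⇒high : ∀ D D′ → tile D ≡ tile D′ → high D ≡ high D′
      tile⇒high D D′ eq with eX , eY ← digits-injective {p} {D % A / a} {D / A / a} {D′ % A / a} {D′ / A / a} (%A/a<p D) (%A/a<p D′) eq =
        cong₂ (λ x y → x * a + y * a * A) eX eY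

    colouring : Colouring K N (q * p) v
    colouring = record
      { colour   = tile ∘ d
      ; colour<m = λ {u} u≤N u≢v → digits-< {p} {q} {d u % A / a} {d u / A / a} (%A/a<p (d u))
          (m<n*o⇒m/o<n (m<n*o⇒m/o<n {d u} {q * a} {A} (d<N u≤N u≢v)))
      ; same⇒K   = λ {u} {w} _ _ _ _ eq → same-high⇒K (tile⇒high (d u) (d w) eq)
      }

  chartAt : ∀ z → ChartAt K N c z
  chartAt z {I} W W-inj W≤N W∼z = record
    { X = X ; Y = Y
    ; nearX = λ k → proj₁ (near k) ; nearY = λ k → proj₂ (near k)
    ; XY-injective = λ eX eY → d-injective (trans (m≡m%n+[m/n]*n _ A)
        (trans (cong₂ (λ x y → x + y * A) eX eY) (sym (m≡m%n+[m/n]*n _ A))))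
    }
    where
    -- Moves `z` to the cell `(c , c)`, so that everything compatible with `z` has coordinates
    -- between `0` and `2c`.
    shift : ℕ
    shift = c + c * A

    d : ℕ → ℕ
    d u = (u + N * z + shift) % n

    d≈ : ∀ u → d u ≈ u + (N * z + shift)
    d≈ u = subst (d u ≈_) (+-assoc u (N * z) shift) (%-≈ (u + N * z + shift))

    X Y : I → ℕ
    X i = d (W i) % A
    Y i = d (W i) / A

    d-injective : ∀ {i j} → d (W i) ≡ d (W j) → i ≡ j
    d-injective {i} {j} eq = W-inj (≈-small (W≤N i) (W≤N j) (≈-cancel (N * z + shift)
      (≈-trans (≈-sym (d≈ (W i))) (subst (_≈ W j + (N * z + shift)) (sym eq) (d≈ (W j))))))

    3c<3+_*a : ∀ k → c + c + c < (3 + k) * a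
    3c<3+ k *a = ≤-trans (≤-reflexive (arith₁ c)) (≤-trans (m≤m+n _ (2 + k * a)) (≤-reflexive (arith₂ c k)))
      where
      arith₁ : ∀ c → suc (c + c + c) ≡ 1 + (c + c + c)
      arith₁ = solve-∀
      arith₂ : ∀ c k → 1 + (c + c + c) + (2 + k * suc c) ≡ (3 + k) * suc c
      arith₂ = solve-∀

    -- Congruences between such numbers are equalities, which can then be compared digit by digit.
    ≤3c⇒≤N : ∀ {x y} → x ≤ c + c + c → y ≤ c + c + c → x + y * A ≤ N
    ≤3c⇒≤N x≤ y≤ = <⇒≤ (digits-< (≤-<-trans x≤ (3c<3+ p₀ *a)) (≤-<-trans y≤ (3c<3+ q₀ *a)))

    2c≤3c : c + c ≤ c + c + c
    2c≤3c = m≤m+n (c + c) c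

    -- The displacement from `z` is `(i′ - i , j′ - j)`; adding `(c , c)` makes both digits
    -- nonnegative.
    near-centre : ∀ {u} → K u z → d u % A ≤ c + c × d u / A ≤ c + c
    near-centre {u} (step {i} {i′} {j} {j′} i≤ i′≤ j≤ j′≤ eq) =
      subst₂ (λ x y → x ≤ c + c × y ≤ c + c) (sym (proj₁ dig)) (sym (proj₂ dig)) (x≤ , y≤)
      where
      x y : ℕ
      x = (c ∸ i) + i′
      y = (c ∸ j) + j′
      x≤ : x ≤ c + c
      x≤ = +-mono-≤ (m∸n≤m c i) i′≤
      y≤ : y ≤ c + c
      y≤ = +-mono-≤ (m∸n≤m c j) j′≤

      arith₁ : ∀ u M s → u + M + s ≡ u + s + M
      arith₁ = solve-∀
      arith₂ : ∀ z w M i j i° j° A → z + w + (M + ((i° + i) + (j° + j) * A)) ≡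
                                     (w + ((i° + j° * A) + (i + j * A)) + M) + z
      arith₂ = solve-∀
      arith₃ : ∀ i i′ j j′ i° j° A → i′ + j′ * A + ((i° + j° * A) + (i + j * A)) ≡
                                     ((i° + i′) + (j° + j′) * A) + (i + j * A)
      arith₃ = solve-∀

      d≈x+yA : d u ≈ x + y * A
      d≈x+yA = ≈-cancel (i + j * A) (begin
        d u + (i + j * A)                          ≈⟨ ≈-+ (i + j * A) (d≈ u) ⟩
        u + (N * z + shift) + (i + j * A)          ≡⟨ arith₁ u (N * z + shift) (i + j * A) ⟩
        u + (i + j * A) + (N * z + shift)          ≈⟨ ≈-+ (N * z + shift) eq ⟩
        z + (i′ + j′ * A) + (N * z + shift)        ≡⟨ cong (λ s → z + (i′ + j′ * A) + (N * z + s))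
                                                          (cong₂ (λ x y → x + y * A) (sym (m∸n+n≡m i≤)) (sym (m∸n+n≡m j≤))) ⟩
        z + (i′ + j′ * A) + (N * z + (((c ∸ i) + i) + ((c ∸ j) + j) * A))
                                                     ≡⟨ arith₂ z (i′ + j′ * A) (N * z) i j (c ∸ i) (c ∸ j) A ⟩
        (i′ + j′ * A + (((c ∸ i) + (c ∸ j) * A) + (i + j * A)) + N * z) + z
                                                     ≈⟨ ≈-mult (i′ + j′ * A + (((c ∸ i) + (c ∸ j) * A) + (i + j * A))) z ⟩
        i′ + j′ * A + (((c ∸ i) + (c ∸ j) * A) + (i + j * A))
                                                     ≡⟨ arith₃ i i′ j j′ (c ∸ i) (c ∸ j) A ⟩
        x + y * A + (i + j * A)                    ∎)
        where open ≈-Reasoning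

      d≡ : d u ≡ x + y * A
      d≡ = ≈-small (s≤s⁻¹ (m%n<n (u + N * z + shift) n)) (≤3c⇒≤N (≤-trans x≤ 2c≤3c) (≤-trans y≤ 2c≤3c)) d≈x+yA

      dig : d u % A ≡ x × d u / A ≡ y
      dig = digits-injective (m%n<n (d u) A) (≤-<-trans (≤-trans x≤ 2c≤3c) (3c<3+ p₀ *a))
        (trans (sym (m≡m%n+[m/n]*n (d u) A)) d≡)

    +≡⇒< : ∀ {x i y j} → j ≤ c → x + i ≡ y + j → x < y + suc c
    +≡⇒< {x} {i} {y} {j} j≤ eq = ≤-<-trans (m≤m+n x i) (≤-<-trans (≤-reflexive eq) (+-monoʳ-< y (s≤s j≤)))

    -- Coordinates up to `2c` plus offsets up to `c` stay within `3c`, so the congruence splits into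
    -- one equation per coordinate.
    near : ∀ {s t} → K (W s) (W t) → X s < X t + suc c × Y s < Y t + suc c
    near {s} {t} (step {i} {i′} {j} {j′} i≤ i′≤ j≤ j′≤ eq) = +≡⇒< i′≤ (proj₁ dig) , +≡⇒< j′≤ (proj₂ dig)
      where
      arith₁ : ∀ x y i j A → (x + i) + (y + j) * A ≡ (x + y * A) + (i + j * A)
      arith₁ = solve-∀
      arith₂ : ∀ u M s → u + M + s ≡ u + s + M
      arith₂ = solve-∀

      lift : ∀ s i j → (X s + i) + (Y s + j) * A ≈ W s + (i + j * A) + (N * z + shift)
      lift s i j = begin
        (X s + i) + (Y s + j) * A                      ≡⟨ arith₁ (X s) (Y s) i j A ⟩
        (X s + Y s * A) + (i + j * A)                  ≡⟨ cong (_+ (i + j * A)) (m≡m%n+[m/n]*n (d (W s)) A) ⟨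
        d (W s) + (i + j * A)                          ≈⟨ ≈-+ (i + j * A) (d≈ (W s)) ⟩
        W s + (N * z + shift) + (i + j * A)            ≡⟨ arith₂ (W s) (N * z + shift) (i + j * A) ⟩
        W s + (i + j * A) + (N * z + shift)            ∎
        where open ≈-Reasoning

      X≤ : ∀ s {i} → i ≤ c → X s + i ≤ c + c + c
      X≤ s i≤ = +-mono-≤ (proj₁ (near-centre (W∼z s))) i≤
      Y≤ : ∀ s {i} → i ≤ c → Y s + i ≤ c + c + c
      Y≤ s i≤ = +-mono-≤ (proj₂ (near-centre (W∼z s))) i≤

      dig : X s + i ≡ X t + i′ × Y s + j ≡ Y t + j′
      dig = digits-injective (≤-<-trans (X≤ s i≤) (3c<3+ p₀ *a)) (≤-<-trans (X≤ t i′≤) (3c<3+ p₀ *a))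
        (≈-small (≤3c⇒≤N (X≤ s i≤) (Y≤ s j≤)) (≤3c⇒≤N (X≤ t i′≤) (Y≤ t j′≤))
          (≈-trans (lift s i j) (≈-trans (≈-+ (N * z + shift) eq) (≈-sym (lift t i′ j′)))))

-- Boards and their gluing at a vertex.

record Board (c N m : ℕ) (Centre : ℕ → Set) : Set₁ where
  field
    K         : ℕ → ℕ → Set
    K?        : ∀ u v → Dec (K u v)
    K-refl    : ∀ {u} → K u u
    K-sym     : ∀ {u v} → K u v → K v u
    colouring : ∀ v → v ≤ N → Colouring K N m v
    -- `Centre` holds everywhere for a torus and excludes the glued vertex for a wedge.
    chartAt   : ∀ z → Centre z → ChartAt K N c z

torus : ∀ c p₀ q₀ → Board c (Torus.N c p₀ q₀) ((3 + q₀) * (3 + p₀)) (λ _ → ⊤)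
torus c p₀ q₀ = record { K = K ; K? = K? ; K-refl = K-refl ; K-sym = K-sym ; colouring = colouring ; chartAt = λ z _ → chartAt z }
  where open Torus c p₀ q₀

Chart-map : ∀ {V : Set} {K K′ : V → V → Set} {c} → (∀ {u v} → K′ u v → K u v) → Chart K c → Chart K′ c
Chart-map f φ = record { X = X ; Y = Y ; nearX = nearX ∘ f ; nearY = nearY ∘ f ; XY-injective = XY-injective }
  where open Chart φ

module _ {c N₁ N₂ m₁ m₂ : ℕ} (b₁ : Board c N₁ m₁ (λ _ → ⊤)) (b₂ : Board c N₂ m₂ (λ _ → ⊤)) where
  private
    module B₁ = Board b₁
    module B₂ = Board b₂

    N = N₁ + N₂

    ∸-≤ : ∀ {u} → u ≤ N → u ∸ N₁ ≤ N₂
    ∸-≤ = m≤n+o⇒m∸n≤o _ N₁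

    -- The boards occupy `0` to `N₁` and `N₁` to `N₁ + N₂`; the glued vertex `N₁` is number `0` of
    -- the second.
    K : ℕ → ℕ → Set
    K u v = (u ≤ N₁ × v ≤ N₁ × B₁.K u v) ⊎ (N₁ ≤ u × N₁ ≤ v × B₂.K (u ∸ N₁) (v ∸ N₁))

    K? : ∀ u v → Dec (K u v)
    K? u v = (u ≤? N₁ ×-dec v ≤? N₁ ×-dec B₁.K? u v) ⊎-dec (N₁ ≤? u ×-dec N₁ ≤? v ×-dec B₂.K? (u ∸ N₁) (v ∸ N₁))

    K-refl : ∀ {u} → K u u
    K-refl {u} with ≤-total u N₁
    ... | inj₁ u≤ = inj₁ (u≤ , u≤ , B₁.K-refl)
    ... | inj₂ ≤u = inj₂ (≤u , ≤u , B₂.K-refl)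

    K-sym : ∀ {u v} → K u v → K v u
    K-sym (inj₁ (u≤ , v≤ , k)) = inj₁ (v≤ , u≤ , B₁.K-sym k)
    K-sym (inj₂ (≤u , ≤v , k)) = inj₂ (≤v , ≤u , B₂.K-sym k)

    -- A pair lying in both boards is the glued vertex taken twice, where reflexivity suffices.
    K⇒K₁ : ∀ {u v} → u ≤ N₁ → v ≤ N₁ → K u v → B₁.K u v
    K⇒K₁ _  _  (inj₁ (_ , _ , k)) = k
    K⇒K₁ u≤ v≤ (inj₂ (≤u , ≤v , _)) with refl ← ≤-antisym u≤ ≤u | refl ← ≤-antisym v≤ ≤v = B₁.K-refl

    K⇒K₂ : ∀ {u v} → N₁ ≤ u → N₁ ≤ v → K u v → B₂.K (u ∸ N₁) (v ∸ N₁)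
    K⇒K₂ _  _  (inj₂ (_ , _ , k)) = k
    K⇒K₂ ≤u ≤v (inj₁ (u≤ , v≤ , _)) with refl ← ≤-antisym u≤ ≤u | refl ← ≤-antisym v≤ ≤v = B₂.K-refl

    -- A vertex other than `N₁` lies in one board and is compatible only with vertices of that
    -- board, so it inherits a chart.
    chartAt : ∀ z → z ≢ N₁ → ChartAt K N c z
    chartAt z z≢N₁ W W-inj W≤N W∼z with <-cmp z N₁
    ... | tri≈ _ z≡N₁ _ = contradiction z≡N₁ z≢N₁
    ... | tri< z<N₁ _ _ = Chart-map (λ {i} {j} → K⇒K₁ (proj₁ (at i)) (proj₁ (at j)))
        (B₁.chartAt z tt W W-inj (proj₁ ∘ at) (proj₂ ∘ at))
      where
      at : ∀ i → W i ≤ N₁ × B₁.K (W i) z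
      at i with W∼z i
      ... | inj₁ (W≤ , _ , k) = W≤ , k
      ... | inj₂ (_ , ≤z , _) = contradiction z<N₁ (≤⇒≯ ≤z)
    ... | tri> _ _ z>N₁ = Chart-map (λ {i} {j} → K⇒K₂ (proj₁ (at i)) (proj₁ (at j)))
        (B₂.chartAt (z ∸ N₁) tt (λ i → W i ∸ N₁)
          (λ {i} {j} → W-inj ∘ ∸-cancelʳ-≡ (proj₁ (at i)) (proj₁ (at j))) (∸-≤ ∘ W≤N) (proj₂ ∘ at))
      where
      at : ∀ i → N₁ ≤ W i × B₂.K (W i ∸ N₁) (z ∸ N₁)
      at i with W∼z i
      ... | inj₁ (_ , z≤ , _) = contradiction z>N₁ (≤⇒≯ z≤)
      ... | inj₂ (≤W , _ , k) = ≤W , k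

    module _ (v : ℕ) (v≤N : v ≤ N) where
      -- Clamping `v` to each board makes a board not containing `v` drop the glued vertex, which
      -- the other board colours. If `v` is `N₁`, both drop it.
      module F₁ = Colouring (B₁.colouring (v ⊓ N₁) (m⊓n≤n v N₁))
      module F₂ = Colouring (B₂.colouring (v ∸ N₁) (∸-≤ v≤N))

      Left Right : ℕ → Set
      Left  u = u ≤ N₁ × u ≢ v ⊓ N₁
      Right u = N₁ ≤ u × u ∸ N₁ ≢ v ∸ N₁

      left? : ∀ u → Dec (Left u)
      left? u = u ≤? N₁ ×-dec ¬? (u ≟ v ⊓ N₁)

      ¬left⇒right : ∀ {u} → u ≢ v → ¬ Left u → Right u
      ¬left⇒right {u} u≢v ¬left with u ≤? N₁
      ... | no u≰N₁ = <⇒≤ (≰⇒> u≰N₁) , λ eq → [ v≤N₁⇒ eq , v≥N₁⇒ eq ]′ (≤-total v N₁)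
        where
        v≤N₁⇒ : u ∸ N₁ ≡ v ∸ N₁ → v ≤ N₁ → ⊥
        v≤N₁⇒ eq v≤ = u≰N₁ (m∸n≡0⇒m≤n (trans eq (m≤n⇒m∸n≡0 v≤)))
        v≥N₁⇒ : u ∸ N₁ ≡ v ∸ N₁ → N₁ ≤ v → ⊥
        v≥N₁⇒ eq ≤v = u≢v (∸-cancelʳ-≡ (<⇒≤ (≰⇒> u≰N₁)) ≤v eq)
      ... | yes u≤N₁ with u ≟ v ⊓ N₁
      ...   | no u≢ = contradiction (u≤N₁ , u≢) ¬left
      ...   | yes refl with ≤-total v N₁
      ...     | inj₁ v≤ = contradiction (m≤n⇒m⊓n≡m v≤) u≢v
      -- Here `u` is the glued vertex and `v` lies beyond it, so the second board colours `u`.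
      ...     | inj₂ ≤v rewrite m≥n⇒m⊓n≡n ≤v = ≤-refl , λ eq →
                u≢v (≤-antisym ≤v (m∸n≡0⇒m≤n (trans (sym eq) (n∸n≡0 N₁))))

      pick : ∀ u → Dec (Left u) → ℕ
      pick u (yes _) = F₁.colour u
      pick u (no _)  = m₁ + F₂.colour (u ∸ N₁)

      pick< : ∀ {u} → u ≤ N → u ≢ v → ∀ l → pick u l < m₁ + m₂
      pick< _ _ (yes (u≤ , u≢)) = <-≤-trans (F₁.colour<m u≤ u≢) (m≤m+n m₁ m₂)
      pick< u≤N u≢v (no ¬l) = +-monoʳ-< m₁ (F₂.colour<m (∸-≤ u≤N) (proj₂ (¬left⇒right u≢v ¬l)))

      pick⇒K : ∀ {u w} → u ≤ N → w ≤ N → u ≢ v → w ≢ v → ∀ l l′ → pick u l ≡ pick w l′ → K u w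
      pick⇒K _ _ _ _ (yes (u≤ , u≢)) (yes (w≤ , w≢)) eq = inj₁ (u≤ , w≤ , F₁.same⇒K u≤ w≤ u≢ w≢ eq)
      pick⇒K _ _ _ _ (yes (u≤ , u≢)) (no _) eq =
        contradiction (F₁.colour<m u≤ u≢) (≤⇒≯ (≤-trans (m≤m+n m₁ _) (≤-reflexive (sym eq))))
      pick⇒K _ _ _ _ (no _) (yes (w≤ , w≢)) eq =
        contradiction (F₁.colour<m w≤ w≢) (≤⇒≯ (≤-trans (m≤m+n m₁ _) (≤-reflexive eq)))
      pick⇒K u≤N w≤N u≢v w≢v (no ¬l) (no ¬l′) eq
        with ≤u , u≢ ← ¬left⇒right u≢v ¬l | ≤w , w≢ ← ¬left⇒right w≢v ¬l′
        = inj₂ (≤u , ≤w , F₂.same⇒K (∸-≤ u≤N) (∸-≤ w≤N) u≢ w≢ (+-cancelˡ-≡ m₁ _ _ eq))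

      colouring : Colouring K N (m₁ + m₂) v
      colouring = record
        { colour   = λ u → pick u (left? u)
        ; colour<m = λ {u} u≤N u≢v → pick< u≤N u≢v (left? u)
        ; same⇒K   = λ {u} {w} u≤N w≤N u≢v w≢v → pick⇒K u≤N w≤N u≢v w≢v (left? u) (left? w)
        }

  wedge : Board c (N₁ + N₂) (m₁ + m₂) (_≢ N₁)
  wedge = record { K = K ; K? = K? ; K-refl = K-refl ; K-sym = K-sym ; colouring = colouring ; chartAt = chartAt }

-- Colourability under deletion, and endpoints of edge lists.

colourable-deleteEdges : ∀ {n c} (G : Graph n) R → Colourable G c → Colourable (deleteEdges G R) c
colourable-deleteEdges G R (f , proper) = f , λ u v → proper u v ∘ ∧-true
  where
  ∧-true : ∀ {x y} → x ∧ y ≡ true → x ≡ true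
  ∧-true {true} _ = refl

-- `v` receives a fresh colour. This colours the whole graph with `m + 1` colours and, by
-- contraposition, gives the lower bound after deleting a vertex.
colourable-deleteVertex⁻ : ∀ {n c} (G : Graph (suc n)) v → Colourable (deleteVertex G v) c → Colourable G (suc c)
colourable-deleteVertex⁻ {n} {c} G v (f , proper) = (λ u → g u (v Fin.≟ u)) , λ u w → g-proper u w (v Fin.≟ u) (v Fin.≟ w)
  where
  g : ∀ u → Dec (v ≡ u) → Fin (suc c)
  g u (yes _)  = Fin.zero
  g u (no v≢u) = Fin.suc (f (punchOut v≢u))

  g-proper : ∀ u w d d′ → adj G u w ≡ true → g u d ≢ g w d′
  g-proper u w (yes refl) (yes refl) uw _ = case trans (sym uw) (adj-irrefl G v) of λ ()
  g-proper u w (no v≢u) (no v≢w) uw eq = proper (punchOut v≢u) (punchOut v≢w)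
    (trans (cong₂ (adj G) (Fin.punchIn-punchOut v≢u) (Fin.punchIn-punchOut v≢w)) uw) (Fin.suc-injective eq)

endpoints : ∀ {A : Set} → List (A × A) → List A
endpoints []            = []
endpoints ((a , b) ∷ R) = a ∷ b ∷ endpoints R

length-endpoints : ∀ {A : Set} (R : List (A × A)) → length (endpoints R) ≡ length R + length R
length-endpoints []      = refl
length-endpoints (_ ∷ R) = cong suc (trans (cong suc (length-endpoints R)) (sym (+-suc _ _)))

inR⇒∈endpoints : ∀ {n} R {u v : Fin n} → inR R u v ≡ true → u ∈ endpoints R
inR⇒∈endpoints ((a , b) ∷ R) {u} {v} eq with a Fin.≟ u | b Fin.≟ u
... | yes refl | _        = here refl
... | no _     | yes refl = there (here refl)
... | no _     | no _ with a Fin.≟ v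
...   | yes _ = there (there (inR⇒∈endpoints R eq))
...   | no _  = there (there (inR⇒∈endpoints R eq))

-- The graph of a board: criticality and robustness.

module BoardGraph {c N m x : ℕ} (x≤N : x ≤ N) (b : Board c N m (_≢ x)) (size : N ≡ m * (suc c * suc c)) where
  open Board b

  private
    V = Fin (suc N)
    a = suc c

    toℕ≤N : (u : V) → toℕ u ≤ N
    toℕ≤N u = s≤s⁻¹ (Fin.toℕ<n u)

    ¬does⇒¬ : ∀ {P : Set} (P? : Dec P) → not (does P?) ≡ true → ¬ P
    ¬does⇒¬ (no ¬p) _ = ¬p

  graph : Graph (suc N)
  graph = record
    { adj        = λ u v → not (does (K? (toℕ u) (toℕ v)))
    ; adj-sym    = λ u v → cong not (does-⇔ (mk⇔ K-sym K-sym) (K? (toℕ u) (toℕ v)) (K? (toℕ v) (toℕ u)))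
    ; adj-irrefl = λ v → cong not (dec-true (K? (toℕ v) (toℕ v)) K-refl)
    }

  deleteVertex-colourable : ∀ v → Colourable (deleteVertex graph v) m
  deleteVertex-colourable v = f , λ s t st eq →
      ¬does⇒¬ (K? (at s) (at t)) st (same⇒K (at≤N s) (at≤N t) (at≢v s) (at≢v t) (f-injective eq))
    where
    open Colouring (colouring (toℕ v) (toℕ≤N v))
    at : Fin N → ℕ
    at s = toℕ (punchIn v s)
    at≤N : ∀ s → at s ≤ N
    at≤N s = toℕ≤N (punchIn v s)
    at≢v : ∀ s → at s ≢ toℕ v
    at≢v s = Fin.punchInᵢ≢i v s ∘ Fin.toℕ-injective
    f : Fin N → Fin m
    f s = fromℕ< (colour<m (at≤N s) (at≢v s))
    f-injective : ∀ {s t} → f s ≡ f t → colour (at s) ≡ colour (at t)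
    f-injective eq = trans (sym (Fin.toℕ-fromℕ< _)) (trans (cong toℕ eq) (Fin.toℕ-fromℕ< _))

  module _ (R : List (V × V)) (∣R∣ : length R + length R ≤ c) where
    private
      E = endpoints R

      ∣E∣≤c : length E ≤ c
      ∣E∣≤c = ≤-trans (≤-reflexive (length-endpoints R)) ∣R∣

    -- A larger class would have a member outside `special`, hence a chart around it, and the
    -- near-clique bound would then contradict its size.
    class-small : ∀ {ys} → Unique ys →
      (∀ {u v} → u ∈ ys → v ∈ ys → u ∉ E → K (toℕ u) (toℕ v)) → length ys ≤ a * a
    class-small {ys} uniq free⇒K = ≮⇒≥ λ big → <⇒≱ big (<⇒≤ (bound big))
      where
      W : Fin (length ys) → V
      W = lookup ys

      special : List V
      special = fromℕ< (s≤s x≤N) ∷ E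

      module _ (big : a * a < length ys) where
        -- `special` has at most `c + 1 = a` entries, fewer than `ys`.
        not-all-special : ¬ (∀ i → W i ∈ special)
        not-all-special all∈ = <⇒≱ (≤-<-trans (m≤m*n a a) big)
          (≤-trans (Fin.injective⇒≤ {f = λ i → Any.index (all∈ i)}
            (λ {i} {j} → lookup-injective uniq ∘ index-injective (setoid V) (all∈ i) (all∈ j))) (s≤s ∣E∣≤c))

        centre : ∃ λ i → W i ∉ special
        centre = Fin.¬∀⟶∃¬ _ _ (λ i → member? Fin._≟_ (W i) special) not-all-special

        z = W (proj₁ centre)

        z≢x : toℕ z ≢ x
        z≢x eq = proj₂ centre (here (Fin.toℕ-injective (trans eq (sym (Fin.toℕ-fromℕ< _)))))

        slot-or-free : ∀ i → (∃ λ s → lookup E s ≡ W i) ⊎ (∀ j → K (toℕ (W i)) (toℕ (W j)))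
        slot-or-free i with member? Fin._≟_ (W i) E
        ... | yes p = inj₁ (Any.index p , sym (lookup-index p))
        ... | no ∉E = inj₂ λ j → free⇒K (∈-lookup i) (∈-lookup j) ∉E

        chart : Chart (λ i j → K (toℕ (W i)) (toℕ (W j))) c
        chart = chartAt (toℕ z) z≢x (toℕ ∘ W) (lookup-injective uniq ∘ Fin.toℕ-injective) (toℕ≤N ∘ W)
          (λ i → K-sym (free⇒K (∈-lookup (proj₁ centre)) (∈-lookup i) (proj₂ centre ∘ there)))

        -- At most `c` slots give `length ys ≤ c + c * a < a + c * a = a * a`.
        bound : length ys < a * a
        bound = ≤-<-trans (near-clique-small K-sym (λ i s → lookup E s ≡ W i)
          (λ eq eq′ → lookup-injective uniq (trans (sym eq) eq′)) slot-or-free chart big) (+-monoˡ-< (c * a) (s≤s ∣E∣≤c))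

    deleteEdges-not-colourable : ∀ k → k < suc m → ¬ Colourable (deleteEdges graph R) k
    deleteEdges-not-colourable k k≤m (f , proper)
      -- There are `m * (a * a) + 1` vertices, so `k ≤ m` colours leave a class larger than `a * a`.
      with ys , uniq , big , col , same ← large-class (toℕ ∘ f) (a * a) k (Unique.allFin⁺ (suc N))
             (All.universal (λ u → Fin.toℕ<n (f u)) _)
             (s≤s (≤-trans (*-monoˡ-≤ (a * a) (s≤s⁻¹ k≤m)) (≤-reflexive (trans (sym size) (sym (length-tabulate {n = N} Fin.suc))))))
      = <⇒≱ big (class-small uniq λ {u} {v} u∈ v∈ u∉E →
          same⇒K u∉E (Fin.toℕ-injective (trans (All.lookup same u∈) (sym (All.lookup same v∈)))))
      where
      -- An incompatible pair of equal colour must be a deleted edge, making `u` an endpoint.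
      same⇒K : ∀ {u v} → u ∉ E → f u ≡ f v → K (toℕ u) (toℕ v)
      same⇒K {u} {v} u∉E fu≡fv with K? (toℕ u) (toℕ v) | inR R u v in uv∈R | proper u v
      ... | yes k | _     | _ = k
      ... | no _  | true  | _ = contradiction (inR⇒∈endpoints R uv∈R) u∉E
      ... | no _  | false | p = contradiction fu≡fv (p refl)

  graph-not-colourable : ∀ k → k < suc m → ¬ Colourable graph k
  graph-not-colourable k k≤m = deleteEdges-not-colourable [] z≤n k k≤m ∘ colourable-deleteEdges graph []

  graph-colourable : Colourable graph (suc m)
  graph-colourable = colourable-deleteVertex⁻ graph Fin.zero (deleteVertex-colourable Fin.zero)

  graph-critical : VertexCritical graph (suc m)
  graph-critical = (graph-colourable , graph-not-colourable) ,
    λ v → deleteVertex-colourable v , λ k k<m → graph-not-colourable (suc k) (s≤s k<m) ∘ colourable-deleteVertex⁻ graph v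

  graph-robust : ∀ R → length R + length R ≤ c → ChromaticNumber (deleteEdges graph R) (suc m)
  graph-robust R ∣R∣ = colourable-deleteEdges graph R graph-colourable , deleteEdges-not-colourable R ∣R∣

-- Reaching every large number of colours.

29+n≡3s+4t : ∀ n → ∃ λ s → ∃ λ t → (3 + s) * 3 + (3 + t) * 4 ≡ 29 + n
-- The summands are the colour counts of tori with `p = 3` and `p = 4`. Three consecutive base cases
-- suffice, since raising `s` by one adds `3`.
29+n≡3s+4t 0 = 0 , 2 , refl
29+n≡3s+4t 1 = 3 , 0 , refl
29+n≡3s+4t 2 = 2 , 1 , refl
29+n≡3s+4t (suc (suc (suc n))) with s , t , eq ← 29+n≡3s+4t n = suc s , t , trans (cong (3 +_) eq) (arith n)
  where
  arith : ∀ n → 3 + (29 + n) ≡ 29 + (3 + n)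
  arith = solve-∀

theorem1 : ∀ (r : ℕ) → 1 ≤ r →
    Σ ℕ λ k₀ → 1 ≤ k₀ × (∀ (k : ℕ) → k₀ ≤ k →
    Σ ℕ λ n → Σ (Graph (suc n)) λ G →
    VertexCritical G k ×
    (∀ (R : List (Fin (suc n) × Fin (suc n))) → AllEdges G R → length R ≤ r →
    ChromaticNumber (deleteEdges G R) k))
theorem1 r _ = 30 , s≤s z≤n , construct
  where
  -- At most `r` edges have at most `2r` endpoints.
  c = r + r
  construct : ∀ k → 30 ≤ k → _
  construct k 30≤k with s , t , eq ← 29+n≡3s+4t (k ∸ 30) =
    -- The construction yields `m + 1` colours with `m = 29 + (k ∸ 30)`, which is `k` because
    -- `30 ≤ k`.
    subst (λ k → Σ ℕ λ n → Σ (Graph (suc n)) λ G → VertexCritical G k × (∀ R → AllEdges G R → length R ≤ r → ChromaticNumber (deleteEdges G R) k))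
      (trans (cong suc eq) (m+[n∸m]≡n 30≤k))
      (_ , graph , graph-critical , λ R _ ∣R∣≤r → graph-robust R (+-mono-≤ ∣R∣≤r ∣R∣≤r))
    where
    open BoardGraph (m≤m+n _ _) (wedge (torus c 0 s) (torus c 1 t))
      (trans (cong₂ _+_ (Torus.size c 0 s) (Torus.size c 1 t)) (sym (*-distribʳ-+ (suc c * suc c) ((3 + s) * 3) _)))
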